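{- The expected number of rows of the (unshifted) Ferrers diagram underlying a uniformly random type-B permutation tableau of size $n$, i.e. the expected number of south steps on its boundary, equals $\dfrac{n+1}{4}$.
   Context: A Ferrers diagram is a left-justified array of cells whose row lengths weakly decrease from top to bottom (rows of length $0$ are allowed). Its half-perimeter is the number of rows plus the number of columns. Its southeast boundary, traversed from the northeast corner to the southwest corner, consists of $n$ unit steps, each south or west; south steps correspond to rows and west steps to columns. If the diagram has $c$ columns, the shifted Ferrers diagram is obtained by inserting $c$ new left-justified rows above it, of lengths $c,c-1,\dots,1$ from top to bottom; the rightmost cell of each inserted row is a diagonal cell. A type-B permutation tableau of size $n$ is a filling of a shifted Ferrers diagram of half-perimeter $n$ with $0$'s and $1$'s such that: (1) every column contains at least one $1$; (2) no $0$ has both a $1$ above it in its column and a $1$ to its left in its row; (3) if a diagonal cell contains $0$ then every cell of its row contains $0$. Only the rows of the original (unshifted) Ferrers diagram are counted, not the inserted rows. Let $\mathcal{B}_n$ be the set of such tableaux with the uniform probability measure $\mathbb{P}_n$ and expectation $\mathbb{E}_n$.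
   Formalization: The inserted rows are taken with lengths 1, 2, …, c from top to bottom instead of c, c−1, …, 1 (with the latter order the expected number of rows for n = 3 is 12/13, not 1), and n ≥ 1 is assumed, since for n = 0 the expectation is 0, not 1/4. -}

module Defs where

open import Data.Bool using (Bool; true; false)
import Data.Bool.Properties as Bool
open import Data.Empty using (⊥)
open import Data.Fin using (Fin; zero; suc; toℕ)
import Data.Fin as Fin
open import Data.Fin.Properties using (all?; any?)
open import Data.Integer using (+_)
open import Data.List
  using (List; []; _∷_; _++_; [_]; length; lookup; map; filter; applyUpTo;
         concatMap; cartesianProductWith)
open import Data.List.Membership.Propositional using (_∈_; lose)
open import Data.List.Membership.Propositional.Properties
  using (∈-cartesianProductWith⁺; ∈-concatMap⁺; ∈-concatMap⁻; ∈-map⁺; ∈-map⁻;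
         ∈-filter⁺; ∈-filter⁻)
open import Data.List.Relation.Unary.All using (All; []; _∷_)
import Data.List.Relation.Unary.All as All
open import Data.List.Relation.Unary.AllPairs using ([]; _∷_)
open import Data.List.Relation.Unary.Any using (Any; here; there)
open import Data.List.Relation.Unary.Unique.Propositional using (Unique)
open import Data.List.Relation.Unary.Unique.Propositional.Properties
  using (++⁺; map⁺; filter⁺; cartesianProductWith⁺)
open import Data.Nat using (ℕ; zero; suc; _<_; _<?_; NonZero)
open import Data.Nat.ListAction using (sum)
import Data.Nat.Properties as ℕ
open import Data.Product using (Σ; ∃; ∃₂; _×_; _,_; proj₁; proj₂)
open import Data.Rational using (ℚ; _/_)
open import Data.Vec using (Vec; []; _∷_; replicate)
import Data.Vec as Vec
open import Function using (_⇔_; mk⇔; module Equivalence)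
open import Relation.Binary.PropositionalEquality using (_≡_; _≢_; refl; subst; sym; trans)
open import Relation.Nullary using (¬_; Dec; ¬?; _×-dec_; _→-dec_)
import Relation.Nullary.Decidable as Dec

data Step : Set where
  south west : Step

-- A Ferrers diagram of half-perimeter n, given by its southeast boundary read
-- from the northeast corner to the southwest corner.
Ferrers : ℕ → Set
Ferrers n = Vec Step n

columns : ∀ {n} → Ferrers n → ℕ
columns []          = 0
columns (south ∷ D) = columns D
columns (west  ∷ D) = suc (columns D)

-- The row lengths, from top to bottom.  A row ends on the right at its south
-- step, so its length is the number of west steps still to come.
rowLengths : ∀ {n} → Ferrers n → List ℕ
rowLengths []          = []
rowLengths (south ∷ D) = columns D ∷ rowLengths D
rowLengths (west  ∷ D) = rowLengths D

-- With c columns, the inserted rows have lengths 1, 2, …, c from top to bottom: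
-- column k (counted from 0) starts at the diagonal cell of inserted row k.
-- The opposite order c, …, 2, 1 does not give type-B permutation tableaux: for
-- n = 3 it admits 52 fillings instead of 2³ · 3! = 48, and then the expected
-- number of rows is 12/13 instead of 1.
shiftedRowLengths : ∀ {n} → Ferrers n → List ℕ
shiftedRowLengths D = applyUpTo suc (columns D) ++ rowLengths D

-- A filling of the left-justified array with the given row lengths;
-- false stands for 0 and true for 1.
Filling : List ℕ → Set
Filling = All (Vec Bool)

row : ∀ {ls} → Filling ls → (i : Fin (length ls)) → Vec Bool (lookup ls i)
row (r ∷ F) zero    = r
row (r ∷ F) (suc i) = row F i

entry : ∀ {ls} → Filling ls → (i : Fin (length ls)) → Fin (lookup ls i) → Bool
entry F i = Vec.lookup (row F i)

Filled : ℕ → Set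
Filled n = Σ (Ferrers n) λ D → Filling (shiftedRowLengths D)

numRows : ∀ {n} → Filled n → ℕ
numRows (D , _) = length (rowLengths D)

-- Cells of different rows lie in the same column when the values (toℕ) of
-- their column indices agree.
module _ {ls : List ℕ} (F : Filling ls) where

  OneInColumn : ℕ → Set
  OneInColumn k = ∃₂ λ i (j : Fin (lookup ls i)) → toℕ j ≡ k × entry F i j ≡ true

  OneAbove : (i : Fin (length ls)) → Fin (lookup ls i) → Set
  OneAbove i j = ∃₂ λ i′ (j′ : Fin (lookup ls i′)) →
    i′ Fin.< i × toℕ j′ ≡ toℕ j × entry F i′ j′ ≡ true

  OneToTheLeft : (i : Fin (length ls)) → Fin (lookup ls i) → Set
  OneToTheLeft i j = ∃ λ j′ → j′ Fin.< j × entry F i j′ ≡ true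

record IsTypeB {n} (T : Filled n) : Set where
  private
    D  = proj₁ T
    F  = proj₂ T
    ls = shiftedRowLengths D
  field
    column-has-one : (k : Fin (columns D)) → OneInColumn F (toℕ k)
    no-bad-zero    : (i : Fin (length ls)) (j : Fin (lookup ls i)) →
                     entry F i j ≡ false →
                     ¬ (OneAbove F i j × OneToTheLeft F i j)
    -- The inserted rows are the first (columns D) ones; the diagonal cell of
    -- such a row is its last cell.
    diagonal-zero  : (i : Fin (length ls)) → toℕ i < columns D →
                     (j : Fin (lookup ls i)) → suc (toℕ j) ≡ lookup ls i →
                     entry F i j ≡ false → ∀ j′ → entry F i j′ ≡ false

isTypeB? : ∀ {n} (T : Filled n) → Dec (IsTypeB T)
isTypeB? T@(D , F) = Dec.map′
  (λ (p , q , r) → record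
    { column-has-one = p ; no-bad-zero = q ; diagonal-zero = r })
  (λ t → let open IsTypeB t in column-has-one , no-bad-zero , diagonal-zero)
  (   all? (λ k → any? λ i → any? λ j →
        (toℕ j ℕ.≟ toℕ k) ×-dec (entry F i j Bool.≟ true))
  ×-dec all? (λ i → all? λ j → (entry F i j Bool.≟ false) →-dec ¬? (
        any? (λ i′ → any? λ j′ → (i′ Fin.<? i) ×-dec
          ((toℕ j′ ℕ.≟ toℕ j) ×-dec (entry F i′ j′ Bool.≟ true)))
        ×-dec any? (λ j′ → (j′ Fin.<? j) ×-dec (entry F i j′ Bool.≟ true))))
  ×-dec all? (λ i → (toℕ i <? columns D) →-dec all? λ j →
        (suc (toℕ j) ℕ.≟ lookup (shiftedRowLengths D) i) →-dec
        ((entry F i j Bool.≟ false) →-dec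
        all? λ j′ → entry F i j′ Bool.≟ false)))

vectors : ∀ {A : Set} → List A → (n : ℕ) → List (Vec A n)
vectors as zero    = [ [] ]
vectors as (suc n) = cartesianProductWith _∷_ as (vectors as n)

fillings : (ls : List ℕ) → List (Filling ls)
fillings []       = [ [] ]
fillings (l ∷ ls) =
  cartesianProductWith _∷_ (vectors (false ∷ true ∷ []) l) (fillings ls)

allFilled : (n : ℕ) → List (Filled n)
allFilled n = concatMap (λ D → map (D ,_) (fillings (shiftedRowLengths D)))
                        (vectors (south ∷ west ∷ []) n)

-- The set of type-B permutation tableaux of size n, as a list without
-- repetitions (tableaux-unique) of all of them (∈-tableaux).
tableaux : (n : ℕ) → List (Filled n)
tableaux n = filter isTypeB? (allFilled n)

∈-vectors : ∀ {A : Set} {as : List A} → (∀ a → a ∈ as) →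
            ∀ {n} (v : Vec A n) → v ∈ vectors as n
∈-vectors as-full []      = here refl
∈-vectors as-full (a ∷ v) =
  ∈-cartesianProductWith⁺ _∷_ (as-full a) (∈-vectors as-full v)

∈-fillings : ∀ {ls} (F : Filling ls) → F ∈ fillings ls
∈-fillings []      = here refl
∈-fillings (r ∷ F) =
  ∈-cartesianProductWith⁺ _∷_ (∈-vectors bools r) (∈-fillings F)
  where
  bools : ∀ b → b ∈ false ∷ true ∷ []
  bools false = here refl
  bools true  = there (here refl)

∈-allFilled : ∀ {n} (T : Filled n) → T ∈ allFilled n
∈-allFilled (D , F) =
  ∈-concatMap⁺ _ (lose (∈-vectors steps D) (∈-map⁺ (D ,_) (∈-fillings F)))
  where
  steps : ∀ s → s ∈ south ∷ west ∷ []
  steps south = here refl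
  steps west  = there (here refl)

∈-tableaux : ∀ {n} {T : Filled n} → T ∈ tableaux n ⇔ IsTypeB T
∈-tableaux {n} {T} = mk⇔
  (λ T∈ → proj₂ (∈-filter⁻ isTypeB? {xs = allFilled n} T∈))
  (∈-filter⁺ isTypeB? (∈-allFilled T))

vectors-unique : ∀ {A : Set} {as : List A} → Unique as →
                 ∀ n → Unique (vectors as n)
vectors-unique u zero    = [] ∷ []
vectors-unique u (suc n) =
  cartesianProductWith⁺ _∷_ (λ { refl → refl , refl }) u (vectors-unique u n)

fillings-unique : ∀ ls → Unique (fillings ls)
fillings-unique []       = [] ∷ []
fillings-unique (l ∷ ls) =
  cartesianProductWith⁺ _∷_ (λ { refl → refl , refl })
    (vectors-unique (((λ ()) ∷ []) ∷ [] ∷ []) l) (fillings-unique ls)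

allFilled-unique : ∀ n → Unique (allFilled n)
allFilled-unique n =
  go (vectors-unique (((λ ()) ∷ []) ∷ [] ∷ []) n)
  where
  fibre : (D : Ferrers n) → List (Filled n)
  fibre D = map (D ,_) (fillings (shiftedRowLengths D))

  ∈-fibre : ∀ {D T} → T ∈ fibre D → proj₁ T ≡ D
  ∈-fibre {D} T∈ with _ , _ , refl ← ∈-map⁻ (D ,_) T∈ = refl

  go : ∀ {Ds} → Unique Ds → Unique (concatMap fibre Ds)
  go []                  = []
  go {D ∷ Ds} (D∉Ds ∷ u) =
    ++⁺ (map⁺ (λ { refl → refl }) (fillings-unique (shiftedRowLengths D))) (go u)
      λ (p , q) → disjoint p D∉Ds (∈-concatMap⁻ fibre {xs = Ds} q)
    where
    disjoint : ∀ {T Es} → T ∈ fibre D → All (D ≢_) Es →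
               Any (λ E → T ∈ fibre E) Es → ⊥
    disjoint p (D≢E ∷ _) (here q)  = D≢E (trans (sym (∈-fibre p)) (∈-fibre q))
    disjoint p (_ ∷ D∉)  (there q) = disjoint p D∉ q

tableaux-unique : ∀ n → Unique (tableaux n)
tableaux-unique n = filter⁺ isTypeB? (allFilled-unique n)

-- The diagram with no columns carries a (cell-free) tableau.
tableau-exists : ∀ n → ∃ λ (T : Filled n) → IsTypeB T
tableau-exists n = (D , F) , record
  { column-has-one = λ k → noFin (subst Fin (cols n) k)
  ; no-bad-zero    = λ i j → noFin (subst Fin (empty i) j)
  ; diagonal-zero  = λ i _ j → noFin (subst Fin (empty i) j)
  }
  where
  D : Ferrers n
  D = replicate n south

  noFin : {A : Set} → Fin 0 → A
  noFin ()

  cols : ∀ m → columns (replicate m south) ≡ 0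
  cols zero    = refl
  cols (suc m) = cols m

  rows : ∀ m → All (_≡ 0) (rowLengths (replicate m south))
  rows zero    = []
  rows (suc m) = cols m ∷ rows m

  shiftedRows : All (_≡ 0) (shiftedRowLengths D)
  shiftedRows rewrite cols n = rows n

  F : Filling (shiftedRowLengths D)
  F = All.map (λ { refl → [] }) shiftedRows

  empty : ∀ i → lookup (shiftedRowLengths D) i ≡ 0
  empty = at shiftedRows
    where
    at : ∀ {ls} → All (_≡ 0) ls → ∀ i → lookup ls i ≡ 0
    at (p ∷ _)  zero    = p
    at (_ ∷ ps) (suc i) = at ps i

tableaux-nonEmpty : ∀ n → NonZero (length (tableaux n))
tableaux-nonEmpty n with T , t ← tableau-exists n =
  nonEmpty (Equivalence.from ∈-tableaux t)
  where
  nonEmpty : ∀ {A : Set} {x : A} {xs} → x ∈ xs → NonZero (length xs)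
  nonEmpty (here _)  = _
  nonEmpty (there _) = _

-- Expectation of X on the tableaux of size n under the uniform measure.
𝔼 : (n : ℕ) → (Filled n → ℕ) → ℚ
𝔼 n X = + sum (map X (tableaux n)) / length (tableaux n)
  where instance _ = tableaux-nonEmpty n

{-# OPTIONS --safe #-}

-- Call a row of a tableau free if it contains no blocking zero, i.e. no zero
-- with a 1 above it and no diagonal zero.  Appending a west step to the boundary
-- adds a new column on the left (and a new one-cell row on top of it) in which
-- exactly the free rows may carry a 1; appending a south step adds an empty row,
-- which is free.  Let Pₙ(y) be the sum of y^(number of free rows) over the
-- tableaux of size n, and Rₙ(y) the same sum weighted by the number of rows.
-- A tableau with u free rows contributes y^(u+1) by a south step and
-- 2y(1+y)^u − y^(u+1) by a west step, whence
--   Pₙ₊₁(y) = 2y Pₙ(y+1)   and   Rₙ₊₁(y) = y Pₙ(y) + 2y Rₙ(y+1).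
-- Induction gives 4(y+n) Rₙ₊₁(y) = (n+1)(2y+n) Pₙ₊₁(y), and y = 1 is the theorem.

module Submission where

open import Defs
open import Algebra.Properties.CommutativeSemigroup using (interchange)
open import Data.Bool using (Bool; true; false; not; _∧_; _∨_; if_then_else_; T; T?)
open import Data.Bool.Properties
  using (∨-assoc; ∧-assoc; ∧-comm; ∨-identityʳ; ∨-zeroʳ; ∧-identityʳ; ∧-zeroʳ; T-∧; T-∨)
open import Data.Empty using (⊥-elim)
open import Data.Fin using (Fin; zero; suc; toℕ; fromℕ<)
open import Data.Fin.Properties using (toℕ<n; toℕ-fromℕ<; toℕ-injective)
import Data.Integer as ℤ
import Data.Integer.Properties as ℤ
open import Data.List
  using (List; []; _∷_; _++_; [_]; length; lookup; map; concatMap;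
         cartesianProductWith; applyUpTo; filter)
open import Data.List.Properties
  using (map-cong; map-++; map-∘; length-++; length-map; ++-assoc; map-applyUpTo)
open import Data.List.Membership.Propositional.Properties using (∈-lookup)
open import Data.List.Relation.Unary.All using (All; []; _∷_)
import Data.List.Relation.Unary.All as All
open import Data.List.Relation.Unary.All.Properties using (++⁺; applyUpTo⁺₁)
open import Data.Maybe using (Maybe; just; nothing)
open import Data.Maybe.Properties using (just-injective)
open import Data.Nat
  using (ℕ; zero; suc; _+_; _*_; _^_; _≡ᵇ_; _≤_; _<_; z≤n; s≤s; s≤s⁻¹; NonZero)
open import Data.Nat.ListAction using (sum)
open import Data.Nat.ListAction.Properties using (sum-++)
open import Data.Nat.Properties
open import Data.Nat.Tactic.RingSolver using (solve-∀)
open import Data.Product using (∃; _×_; _,_; proj₁; proj₂)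
open import Data.Rational using (_/_)
open import Data.Rational.Properties using (fromℚᵘ-cong)
open import Data.Rational.Unnormalised using (mkℚᵘ; *≡*)
open import Data.Sum using (_⊎_; inj₁; inj₂)
open import Data.Vec using (Vec; []; _∷_; _∷ʳ_)
import Data.Vec as Vec
open import Function using (_∘_; id; _⇔_; mk⇔; module Equivalence)
open import Relation.Binary.PropositionalEquality
  using (_≡_; refl; sym; trans; cong; cong₂; subst; module ≡-Reasoning)
open import Relation.Nullary using (¬_; does; contradiction)
open import Relation.Nullary.Decidable using (does-⇔)
open import Relation.Unary using (Decidable)

open ≡-Reasoning
open Equivalence using (to; from)

private variable
  A B C : Set

-- Finite sums

∑ : List A → (A → ℕ) → ℕ
∑ xs f = sum (map f xs)

∑-cong : ∀ (xs : List A) {f g : A → ℕ} → (∀ x → f x ≡ g x) → ∑ xs f ≡ ∑ xs g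
∑-cong xs f≗g = cong sum (map-cong f≗g xs)

∑-++ : ∀ (xs ys : List A) f → ∑ (xs ++ ys) f ≡ ∑ xs f + ∑ ys f
∑-++ xs ys f = trans (cong sum (map-++ f xs ys)) (sum-++ (map f xs) (map f ys))

∑-map : ∀ (h : A → B) xs f → ∑ (map h xs) f ≡ ∑ xs (f ∘ h)
∑-map h xs f = cong sum (sym (map-∘ xs))

∑-concatMap : ∀ (h : A → List B) xs f →
              ∑ (concatMap h xs) f ≡ ∑ xs λ x → ∑ (h x) f
∑-concatMap h []       f = refl
∑-concatMap h (x ∷ xs) f =
  trans (∑-++ (h x) (concatMap h xs) f) (cong (∑ (h x) f +_) (∑-concatMap h xs f))

∑-product : ∀ (h : A → B → C) xs ys f →
            ∑ (cartesianProductWith h xs ys) f ≡ ∑ xs λ x → ∑ ys λ y → f (h x y)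
∑-product h []       ys f = refl
∑-product h (x ∷ xs) ys f =
  trans (∑-++ (map (h x) ys) (cartesianProductWith h xs ys) f)
        (cong₂ _+_ (∑-map (h x) ys f) (∑-product h xs ys f))

∑-+ : ∀ (xs : List A) f g → ∑ xs (λ x → f x + g x) ≡ ∑ xs f + ∑ xs g
∑-+ []       f g = refl
∑-+ (x ∷ xs) f g = trans (cong (f x + g x +_) (∑-+ xs f g))
  (interchange +-commutativeSemigroup (f x) (g x) (∑ xs f) (∑ xs g))

∑-* : ∀ (xs : List A) k f → ∑ xs (λ x → k * f x) ≡ k * ∑ xs f
∑-* []       k f = sym (*-zeroʳ k)
∑-* (x ∷ xs) k f =
  trans (cong (k * f x +_) (∑-* xs k f)) (sym (*-distribˡ-+ k (f x) (∑ xs f)))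

∑-0 : ∀ (xs : List A) → ∑ xs (λ _ → 0) ≡ 0
∑-0 []       = refl
∑-0 (_ ∷ xs) = ∑-0 xs

∑-swap : ∀ (xs : List A) (ys : List B) (f : A → B → ℕ) →
         ∑ xs (λ x → ∑ ys (f x)) ≡ ∑ ys (λ y → ∑ xs λ x → f x y)
∑-swap []       ys f = sym (∑-0 ys)
∑-swap (x ∷ xs) ys f = trans (cong (∑ ys (f x) +_) (∑-swap xs ys f))
  (sym (∑-+ ys (f x) λ y → ∑ xs λ x → f x y))

private
  swap-* : ∀ a y b → a * (y * b) ≡ y * (a * b)
  swap-* = solve-∀

𝟙 : Bool → ℕ
𝟙 b = if b then 1 else 0

𝟙-∧ : ∀ x y → 𝟙 (x ∧ y) ≡ 𝟙 x * 𝟙 y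
𝟙-∧ false y = refl
𝟙-∧ true  y = sym (+-identityʳ (𝟙 y))

-- Bounded quantifiers

allBelow anyBelow : ℕ → (ℕ → Bool) → Bool
allBelow zero    p = true
allBelow (suc n) p = p 0 ∧ allBelow n (p ∘ suc)
anyBelow zero    p = false
anyBelow (suc n) p = p 0 ∨ anyBelow n (p ∘ suc)

countBelow : ℕ → (ℕ → Bool) → ℕ
countBelow zero    p = 0
countBelow (suc n) p = 𝟙 (p 0) + countBelow n (p ∘ suc)

allBelow-cong : ∀ n {p q} → (∀ a → p a ≡ q a) → allBelow n p ≡ allBelow n q
allBelow-cong zero    p≗q = refl
allBelow-cong (suc n) p≗q = cong₂ _∧_ (p≗q 0) (allBelow-cong n (p≗q ∘ suc))

anyBelow-cong : ∀ n {p q} → (∀ a → p a ≡ q a) → anyBelow n p ≡ anyBelow n q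
anyBelow-cong zero    p≗q = refl
anyBelow-cong (suc n) p≗q = cong₂ _∨_ (p≗q 0) (anyBelow-cong n (p≗q ∘ suc))

countBelow-cong : ∀ n {p q} → (∀ a → p a ≡ q a) → countBelow n p ≡ countBelow n q
countBelow-cong zero    p≗q = refl
countBelow-cong (suc n) p≗q =
  cong₂ _+_ (cong 𝟙 (p≗q 0)) (countBelow-cong n (p≗q ∘ suc))

allBelow-true : ∀ n {p} → (∀ a → p a ≡ true) → allBelow n p ≡ true
allBelow-true zero    p-true = refl
allBelow-true (suc n) p-true = cong₂ _∧_ (p-true 0) (allBelow-true n (p-true ∘ suc))

allBelow-suc : ∀ n p → allBelow (suc n) p ≡ allBelow n p ∧ p n
allBelow-suc zero    p = ∧-identityʳ (p 0)
allBelow-suc (suc n) p =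
  trans (cong (p 0 ∧_) (allBelow-suc n (p ∘ suc))) (sym (∧-assoc (p 0) _ _))

anyBelow-suc : ∀ n p → anyBelow (suc n) p ≡ anyBelow n p ∨ p n
anyBelow-suc zero    p = ∨-identityʳ (p 0)
anyBelow-suc (suc n) p =
  trans (cong (p 0 ∨_) (anyBelow-suc n (p ∘ suc))) (sym (∨-assoc (p 0) _ _))

countBelow-suc : ∀ n p → countBelow (suc n) p ≡ countBelow n p + 𝟙 (p n)
countBelow-suc zero    p = +-identityʳ (𝟙 (p 0))
countBelow-suc (suc n) p =
  trans (cong (𝟙 (p 0) +_) (countBelow-suc n (p ∘ suc))) (sym (+-assoc (𝟙 (p 0)) _ _))

allBelow-∧ : ∀ n p q → allBelow n (λ a → p a ∧ q a) ≡ allBelow n p ∧ allBelow n q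
allBelow-∧ zero    p q = refl
allBelow-∧ (suc n) p q
  rewrite allBelow-∧ n (p ∘ suc) (q ∘ suc) with p 0 | q 0
... | false | _     = refl
... | true  | true  = refl
... | true  | false = sym (∧-zeroʳ (allBelow n (p ∘ suc)))

-- Arrays of cells

-- nothing marks a position outside the diagram.
Array : Set
Array = ℕ → ℕ → Maybe Bool

isOne isZero : Maybe Bool → Bool
isOne  nothing  = false
isOne  (just x) = x
isZero nothing  = false
isZero (just x) = not x

infixr 5 _⇒_
_⇒_ : Bool → Bool → Bool
x ⇒ y = not x ∨ y

-- A zero that forbids a 1 to its left, by condition (2) or (3).
blocking : Array → ℕ → ℕ → Bool
blocking M a b = isZero (M a b) ∧ ((a ≡ᵇ b) ∨ anyBelow a λ a′ → isOne (M a′ b))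

-- Scanning all `c` columns is harmless on a shorter row: a position outside the diagram is not a
-- zero and never blocks.
free : ℕ → Array → ℕ → Bool
free c M a = allBelow c λ b → not (blocking M a b)

-- The recursion peels off the leftmost column, so that prepending a column unfolds by computation
-- into a `free` test for the new cell and the old condition.
noneAfter : ℕ → (ℕ → Bool) → (ℕ → Bool) → Bool
noneAfter zero    p q = true
noneAfter (suc c) p q =
  (p 0 ⇒ allBelow c (not ∘ q ∘ suc)) ∧ noneAfter c (p ∘ suc) (q ∘ suc)

-- Conditions (2) and (3) are merged: both forbid a 1 to the left of a blocking zero in its row. For
-- (3) this suffices because the diagonal cell is the last cell of its row.
valid : ℕ → ℕ → Array → Bool
valid c r M =
  (allBelow c λ b → anyBelow r λ a → isOne (M a b)) ∧
  (allBelow r λ a → noneAfter c (isOne ∘ M a) (blocking M a))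

-- The contribution of one filling to Pₙ(y): zero if some condition fails, otherwise one factor `y`
-- per free row.
weight : ℕ → ℕ → ℕ → Array → ℕ
weight y c r M = 𝟙 (valid c r M) * y ^ countBelow r (free c M)

noneAfter-cong : ∀ c {p p′ q q′} → (∀ b → p b ≡ p′ b) → (∀ b → q b ≡ q′ b) →
                 noneAfter c p q ≡ noneAfter c p′ q′
noneAfter-cong zero    p≗ q≗ = refl
noneAfter-cong (suc c) p≗ q≗ = cong₂ _∧_
  (cong₂ _⇒_ (p≗ 0) (allBelow-cong c λ b → cong not (q≗ (suc b))))
  (noneAfter-cong c (p≗ ∘ suc) (q≗ ∘ suc))

noneAfter-empty : ∀ c {p q} → (∀ b → p b ≡ false) → noneAfter c p q ≡ true
noneAfter-empty zero    p-false = refl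
noneAfter-empty (suc c) p-false rewrite p-false 0 = noneAfter-empty c (p-false ∘ suc)

module _ {M N : Array} (M≗N : ∀ a b → M a b ≡ N a b) where

  blocking-cong : ∀ a b → blocking M a b ≡ blocking N a b
  blocking-cong a b = cong₂ _∧_ (cong isZero (M≗N a b))
    (cong ((a ≡ᵇ b) ∨_) (anyBelow-cong a λ a′ → cong isOne (M≗N a′ b)))

  free-cong : ∀ c a → free c M a ≡ free c N a
  free-cong c a = allBelow-cong c λ b → cong not (blocking-cong a b)

  weight-cong : ∀ y c r → weight y c r M ≡ weight y c r N
  weight-cong y c r = cong₂ _*_
    (cong 𝟙 (cong₂ _∧_
      (allBelow-cong c λ b → anyBelow-cong r λ a → cong isOne (M≗N a b))
      (allBelow-cong r λ a →
        noneAfter-cong c (λ b → cong isOne (M≗N a b)) (blocking-cong a))))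
    (cong (y ^_) (countBelow-cong r (free-cong c)))

-- Adding an empty row at the bottom

-- An empty row offers no 1 to any column, cannot violate the row condition and has no blocking
-- zero; it only adds one free row.
weight-suc : ∀ y c r M → (∀ b → M r b ≡ nothing) →
             weight y c (suc r) M ≡ y * weight y c r M
weight-suc y c r M empty = begin
  𝟙 (valid c (suc r) M) * y ^ countBelow (suc r) (free c M)
    ≡⟨ cong₂ (λ x k → 𝟙 x * y ^ k) (cong₂ _∧_ columns≡ rows≡) free≡ ⟩
  𝟙 (valid c r M) * (y * y ^ countBelow r (free c M))
    ≡⟨ swap-* (𝟙 (valid c r M)) y (y ^ countBelow r (free c M)) ⟩
  y * weight y c r M ∎
  where
  columns≡ : (allBelow c λ b → anyBelow (suc r) λ a → isOne (M a b)) ≡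
             (allBelow c λ b → anyBelow r λ a → isOne (M a b))
  columns≡ = allBelow-cong c λ b → begin
    anyBelow (suc r) (λ a → isOne (M a b))          ≡⟨ anyBelow-suc r _ ⟩
    anyBelow r (λ a → isOne (M a b)) ∨ isOne (M r b)
      ≡⟨ cong (λ m → anyBelow r (λ a → isOne (M a b)) ∨ isOne m) (empty b) ⟩
    anyBelow r (λ a → isOne (M a b)) ∨ false        ≡⟨ ∨-identityʳ _ ⟩
    anyBelow r (λ a → isOne (M a b))                ∎

  ok : ℕ → Bool
  ok a = noneAfter c (isOne ∘ M a) (blocking M a)

  rows≡ : allBelow (suc r) ok ≡ allBelow r ok
  rows≡ = begin
    allBelow (suc r) ok      ≡⟨ allBelow-suc r ok ⟩
    allBelow r ok ∧ ok r
      ≡⟨ cong (allBelow r ok ∧_) (noneAfter-empty c (cong isOne ∘ empty)) ⟩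
    allBelow r ok ∧ true     ≡⟨ ∧-identityʳ _ ⟩
    allBelow r ok            ∎

  free-r : free c M r ≡ true
  free-r = allBelow-true c λ b → cong (λ m →
    not (isZero m ∧ ((r ≡ᵇ b) ∨ anyBelow r λ a′ → isOne (M a′ b)))) (empty b)

  free≡ : countBelow (suc r) (free c M) ≡ suc (countBelow r (free c M))
  free≡ = trans (countBelow-suc r (free c M))
    (trans (cong (λ x → countBelow r (free c M) + 𝟙 x) free-r) (+-comm _ 1))

-- Adding a column on the left

look : ∀ {n} → Vec Bool n → ℕ → Maybe Bool
look []      _       = nothing
look (x ∷ v) zero    = just x
look (x ∷ v) (suc a) = look v a

-- Old cells move one place down and one place right, so diagonal cells keep equal coordinates. The
-- new top row is the diagonal cell `d` alone, and `v` is the rest of the new column.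
extend : ∀ {r} → Bool → Vec Bool r → Array → Array
extend d v M zero    zero    = just d
extend d v M zero    (suc b) = nothing
extend d v M (suc a) zero    = look v a
extend d v M (suc a) (suc b) = M a b

bools : List Bool
bools = false ∷ true ∷ []

-- Here and below `φ` stands for the freeness of the old rows, the only information about the old
-- filling on which the choice of the new column depends.
columnFits : ∀ {r} → Bool → (ℕ → Bool) → Vec Bool r → Bool
columnFits {r} d φ v = (d ∨ anyBelow r (isOne ∘ look v)) ∧
  allBelow r λ a → isOne (look v a) ⇒ φ a

-- Only the new leftmost cell can spoil an old free row: a zero there blocks exactly when the new
-- column has a 1 above it, either `d` or an earlier entry of `v`.
staysFree : ∀ {r} → Bool → (ℕ → Bool) → Vec Bool r → ℕ → Bool
staysFree d φ v a = not (isZero (look v a) ∧ (d ∨ anyBelow a (isOne ∘ look v))) ∧ φ a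

-- The new top row is left out; its factor `y ^ 𝟙 d` enters in `weight-extend`.
columnWeight : ∀ {r} → ℕ → Bool → (ℕ → Bool) → Vec Bool r → ℕ
columnWeight {r} y d φ v = 𝟙 (columnFits d φ v) * y ^ countBelow r (staysFree d φ v)

-- The one-cell top row adds nothing to the old columns, so their ones and their blocking zeros are
-- unchanged. What is new is that the left column needs a 1 and that its ones below the diagonal
-- cell must start free rows.
valid-extend : ∀ c r d (v : Vec Bool r) M →
  valid (suc c) (suc r) (extend d v M) ≡ columnFits d (free c M) v ∧ valid c r M
valid-extend c r d v M = begin
  (z ∧ x) ∧ ((d ⇒ allBelow c (λ _ → true)) ∧ noneAfter c (λ _ → false) (λ _ → false)) ∧
    allBelow r (λ a → (isOne (look v a) ⇒ free c M a) ∧ ok a)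
    ≡⟨ cong ((z ∧ x) ∧_) (cong₂ _∧_ top (allBelow-∧ r _ ok)) ⟩
  (z ∧ x) ∧ (u ∧ allBelow r ok)
    ≡⟨ reorder z x u (allBelow r ok) ⟩
  (z ∧ u) ∧ (x ∧ allBelow r ok) ∎
  where
  ok : ℕ → Bool
  ok a = noneAfter c (isOne ∘ M a) (blocking M a)
  x z u : Bool
  z = d ∨ anyBelow r (isOne ∘ look v)
  x = allBelow c λ b → anyBelow r λ a → isOne (M a b)
  u = allBelow r λ a → isOne (look v a) ⇒ free c M a
  top : (d ⇒ allBelow c (λ _ → true)) ∧ noneAfter c (λ _ → false) (λ _ → false) ≡ true
  top = trans
    (cong₂ (λ s t → (d ⇒ s) ∧ t) (allBelow-true c λ _ → refl) (noneAfter-empty c λ _ → refl))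
    (trans (∧-identityʳ _) (∨-zeroʳ (not d)))
  reorder : ∀ a b c d → (a ∧ b) ∧ (c ∧ d) ≡ (a ∧ c) ∧ (b ∧ d)
  reorder false b c d = refl
  reorder true b c d = begin
    b ∧ (c ∧ d) ≡⟨ ∧-assoc b c d ⟨
    (b ∧ c) ∧ d ≡⟨ cong (_∧ d) (∧-comm b c) ⟩
    (c ∧ b) ∧ d ≡⟨ ∧-assoc c b d ⟩
    c ∧ (b ∧ d) ∎

-- The top row consists of its diagonal cell, hence is free exactly when `d` is 1; this accounts for
-- `𝟙 d`.
free-extend : ∀ c r d (v : Vec Bool r) M →
  countBelow (suc r) (free (suc c) (extend d v M)) ≡
  𝟙 d + countBelow r (staysFree d (free c M) v)
free-extend c r d v M = cong (_+ countBelow r (staysFree d (free c M) v))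
  (trans (cong (λ t → 𝟙 (not (not d ∧ true) ∧ t)) (allBelow-true c λ _ → refl)) (diag d))
  where
  diag : ∀ d → 𝟙 (not (not d ∧ true) ∧ true) ≡ 𝟙 d
  diag false = refl
  diag true  = refl

columnSum : ℕ → Bool → ℕ → (ℕ → Bool) → ℕ
columnSum y d r φ = ∑ (vectors bools r) (columnWeight y d φ)

𝟙-∧-^ : ∀ b x y k → 𝟙 (b ∧ x) * y ^ (𝟙 b + k) ≡ 𝟙 b * y * (𝟙 x * y ^ k)
𝟙-∧-^ false x y k = refl
𝟙-∧-^ true  x y k = trans (swap-* (𝟙 x) y (y ^ k))
  (cong (_* (𝟙 x * y ^ k)) (sym (*-identityˡ y)))

𝟙-^ : ∀ b x y k → x * y ^ (𝟙 b + k) ≡ y ^ 𝟙 b * (x * y ^ k)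
𝟙-^ b x y k = trans (cong (x *_) (^-distribˡ-+-* y (𝟙 b) k)) (swap-* x (y ^ 𝟙 b) (y ^ k))

columnSum-suc : ∀ y d r φ → columnSum y d (suc r) φ ≡
  ∑ (vectors bools r) (λ v → columnWeight y d φ (false ∷ v)) +
  ∑ (vectors bools r) (λ v → columnWeight y d φ (true ∷ v))
columnSum-suc y d r φ = trans (∑-product _∷_ bools (vectors bools r) (columnWeight y d φ))
  (cong (∑ (vectors bools r) (λ v → columnWeight y d φ (false ∷ v)) +_) (+-identityʳ _))

-- Below a 1, a zero in the first cell ends the freeness of its row (factor 1), while a 1 is allowed
-- only in a free row and keeps it free (factor `y`).
columnSum-true-suc : ∀ y r φ → columnSum y true (suc r) φ ≡
  columnSum y true r (φ ∘ suc) + 𝟙 (φ 0) * y * columnSum y true r (φ ∘ suc)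
columnSum-true-suc y r φ = trans (columnSum-suc y true r φ)
  (cong (columnSum y true r (φ ∘ suc) +_)
    (trans (∑-cong (vectors bools r) λ v → 𝟙-∧-^ (φ 0) _ y _)
           (∑-* (vectors bools r) (𝟙 (φ 0) * y) (columnWeight y true (φ ∘ suc)))))

-- With no 1 above, a zero leaves its row as it was and the column still lacks a 1. A 1 must lie in
-- a free row, and the cells below it are then governed by `columnSum y true`.
columnSum-false-suc : ∀ y r φ → columnSum y false (suc r) φ ≡
  y ^ 𝟙 (φ 0) * columnSum y false r (φ ∘ suc) +
  𝟙 (φ 0) * y * columnSum y true r (φ ∘ suc)
columnSum-false-suc y r φ = trans (columnSum-suc y false r φ) (cong₂ _+_
  (trans (∑-cong (vectors bools r) λ v → 𝟙-^ (φ 0) (𝟙 (columnFits false (φ ∘ suc) v)) y _)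
         (∑-* (vectors bools r) (y ^ 𝟙 (φ 0)) (columnWeight y false (φ ∘ suc))))
  (trans (∑-cong (vectors bools r) λ v → 𝟙-∧-^ (φ 0) _ y _)
         (∑-* (vectors bools r) (𝟙 (φ 0) * y) (columnWeight y true (φ ∘ suc)))))

columnSum-true : ∀ y r φ → columnSum y true r φ ≡ suc y ^ countBelow r φ
columnSum-true y zero    φ = refl
columnSum-true y (suc r) φ
  rewrite columnSum-true-suc y r φ | columnSum-true y r (φ ∘ suc) =
  step (φ 0) y (countBelow r (φ ∘ suc))
  where
  step : ∀ b y k → suc y ^ k + 𝟙 b * y * suc y ^ k ≡ suc y ^ (𝟙 b + k)
  step false y k = +-identityʳ _
  step true  y k = cong (λ z → suc y ^ k + z * suc y ^ k) (*-identityˡ y)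

-- The topmost 1 lies in a free row; with u free rows, i of them above it, the contribution is yⁱ ·
-- y · (1+y)^(u-1-i). The sum over i telescopes to y(1+y)^u - y·y^u, whose negative term is moved to
-- the left to stay within ℕ.
columnSum-false : ∀ y r φ →
  columnSum y false r φ + y * y ^ countBelow r φ ≡ y * suc y ^ countBelow r φ
columnSum-false y zero    φ = refl
columnSum-false y (suc r) φ
  rewrite columnSum-false-suc y r φ | columnSum-true y r (φ ∘ suc) =
  step (φ 0) (columnSum y false r (φ ∘ suc)) (countBelow r (φ ∘ suc))
    (columnSum-false y r (φ ∘ suc))
  where
  rearrange : ∀ y s t u → y * 1 * s + 1 * y * t + y * (y * u) ≡ y * (s + y * u) + y * t
  rearrange = solve-∀
  collect : ∀ y t → y * (y * t) + y * t ≡ y * (t + y * t)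
  collect = solve-∀
  step : ∀ b s k → s + y * y ^ k ≡ y * suc y ^ k →
    y ^ 𝟙 b * s + 𝟙 b * y * suc y ^ k + y * y ^ (𝟙 b + k) ≡ y * suc y ^ (𝟙 b + k)
  step false s k ih =
    trans (cong (_+ y * y ^ k) (trans (+-identityʳ _) (*-identityˡ s))) ih
  step true s k ih = begin
    y * 1 * s + 1 * y * suc y ^ k + y * (y * y ^ k) ≡⟨ rearrange y s (suc y ^ k) (y ^ k) ⟩
    y * (s + y * y ^ k) + y * suc y ^ k             ≡⟨ cong (λ z → y * z + y * suc y ^ k) ih ⟩
    y * (y * suc y ^ k) + y * suc y ^ k             ≡⟨ collect y (suc y ^ k) ⟩
    y * (suc y * suc y ^ k)                         ∎

weight-extend : ∀ y c r d (v : Vec Bool r) M →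
  weight y (suc c) (suc r) (extend d v M) ≡
  𝟙 (valid c r M) * (y ^ 𝟙 d * columnWeight y d (free c M) v)
weight-extend y c r d v M
  rewrite valid-extend c r d v M | free-extend c r d v M
        | 𝟙-∧ (columnFits d (free c M) v) (valid c r M)
        | ^-distribˡ-+-* y (𝟙 d) (countBelow r (staysFree d (free c M) v)) =
  rearrange (𝟙 (columnFits d (free c M) v)) (𝟙 (valid c r M)) (y ^ 𝟙 d) _
  where
  rearrange : ∀ f v a b → f * v * (a * b) ≡ v * (a * (f * b))
  rearrange = solve-∀

-- The added term is what an empty bottom row contributes by `weight-suc`. It cancels the defect in
-- `columnSum-false`, after which both values of `d` contribute y(1+y)^u, where u is the number of
-- free rows.
∑-weight-extend : ∀ y c r M →
  ∑ bools (λ d → ∑ (vectors bools r) λ v → weight y (suc c) (suc r) (extend d v M)) +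
  y * weight y c r M ≡ 2 * y * weight (suc y) c r M
∑-weight-extend y c r M = begin
  ∑ bools (λ d → ∑ (vectors bools r) λ v → weight y (suc c) (suc r) (extend d v M)) + y * (w * Y)
    ≡⟨ cong (_+ y * (w * Y)) (∑-cong bools λ d → trans
         (∑-cong (vectors bools r) λ v → weight-extend y c r d v M)
         (trans (∑-* (vectors bools r) w _)
           (cong (w *_) (∑-* (vectors bools r) (y ^ 𝟙 d) (columnWeight y d (free c M)))))) ⟩
  w * (1 * S false) + (w * (y * 1 * S true) + 0) + y * (w * Y)
    ≡⟨ rearrange w y (S false) (S true) Y ⟩
  w * ((S false + y * Y) + y * S true)
    ≡⟨ cong₂ (λ s t → w * (s + y * t)) (columnSum-false y r (free c M)) (columnSum-true y r (free c M)) ⟩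
  w * (y * Z + y * Z)
    ≡⟨ collect w y Z ⟩
  2 * y * (w * Z) ∎
  where
  w Y Z : ℕ
  w = 𝟙 (valid c r M)
  Y = y ^ countBelow r (free c M)
  Z = suc y ^ countBelow r (free c M)
  S : Bool → ℕ
  S d = columnSum y d r (free c M)
  rearrange : ∀ w y s t u →
    w * (1 * s) + (w * (y * 1 * t) + 0) + y * (w * u) ≡ w * ((s + y * u) + y * t)
  rearrange = solve-∀
  collect : ∀ w y z → w * (y * z + y * z) ≡ 2 * y * (w * z)
  collect = solve-∀

-- Sums over fillings

cell : ∀ {ls} → Filling ls → Array
cell []      _       _ = nothing
cell (w ∷ F) zero    b = look w b
cell (w ∷ F) (suc a) b = cell F a b

appendEmpty : ∀ {ls} → Filling ls → Filling (ls ++ [ 0 ])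
appendEmpty F = ++⁺ F ([] ∷ [])

cell-appendEmpty : ∀ {ls} (F : Filling ls) a b → cell (appendEmpty F) a b ≡ cell F a b
cell-appendEmpty []      zero    b = refl
cell-appendEmpty []      (suc a) b = refl
cell-appendEmpty (w ∷ F) zero    b = refl
cell-appendEmpty (w ∷ F) (suc a) b = cell-appendEmpty F a b

cell-length : ∀ {ls} (F : Filling ls) b → cell F (length ls) b ≡ nothing
cell-length []      b = refl
cell-length (w ∷ F) b = cell-length F b

prepend : ∀ {ls} → Vec Bool (length ls) → Filling ls → Filling (map suc ls)
prepend {[]}     []      []      = []
prepend {_ ∷ ls} (x ∷ v) (w ∷ F) = (x ∷ w) ∷ prepend v F

cell-prepend : ∀ {ls} d (v : Vec Bool (length ls)) (F : Filling ls) a b →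
               cell {1 ∷ map suc ls} ((d ∷ []) ∷ prepend v F) a b ≡ extend d v (cell F) a b
cell-prepend d v       F       zero          zero    = refl
cell-prepend d v       F       zero          (suc b) = refl
cell-prepend d []      []      (suc a)       zero    = refl
cell-prepend d []      []      (suc a)       (suc b) = refl
cell-prepend d (x ∷ v) (w ∷ F) (suc zero)    zero    = refl
cell-prepend d (x ∷ v) (w ∷ F) (suc zero)    (suc b) = refl
cell-prepend d (x ∷ v) (w ∷ F) (suc (suc a)) zero    = cell-prepend d v F (suc a) zero
cell-prepend d (x ∷ v) (w ∷ F) (suc (suc a)) (suc b) = cell-prepend d v F (suc a) (suc b)

∑-fillings-∷ : ∀ l ls g →
  ∑ (fillings (l ∷ ls)) g ≡ ∑ (vectors bools l) λ w → ∑ (fillings ls) λ F → g (w ∷ F)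
∑-fillings-∷ l ls g = ∑-product _∷_ (vectors bools l) (fillings ls) g

∑-fillings-appendEmpty : ∀ ls g →
  ∑ (fillings (ls ++ [ 0 ])) g ≡ ∑ (fillings ls) (g ∘ appendEmpty)
∑-fillings-appendEmpty []       g = refl
∑-fillings-appendEmpty (l ∷ ls) g = begin
  ∑ (fillings (l ∷ ls ++ [ 0 ])) g
    ≡⟨ ∑-fillings-∷ l (ls ++ [ 0 ]) g ⟩
  ∑ (vectors bools l) (λ w → ∑ (fillings (ls ++ [ 0 ])) λ F → g (w ∷ F))
    ≡⟨ ∑-cong (vectors bools l) (λ w → ∑-fillings-appendEmpty ls (g ∘ (w ∷_))) ⟩
  ∑ (vectors bools l) (λ w → ∑ (fillings ls) λ F → g (w ∷ appendEmpty F))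
    ≡⟨ ∑-fillings-∷ l ls (g ∘ appendEmpty) ⟨
  ∑ (fillings (l ∷ ls)) (g ∘ appendEmpty) ∎

-- `fillings` runs row by row. Each row is split into its new left cell and its old part, and the
-- sums are exchanged so that the new cells gather into one column vector.
∑-fillings-map-suc : ∀ ls g → ∑ (fillings (map suc ls)) g ≡
  ∑ (vectors bools (length ls)) λ v → ∑ (fillings ls) λ F → g (prepend v F)
∑-fillings-map-suc []       g = sym (+-identityʳ _)
∑-fillings-map-suc (l ∷ ls) g = begin
  ∑ (fillings (suc l ∷ map suc ls)) g
    ≡⟨ ∑-fillings-∷ (suc l) (map suc ls) g ⟩
  ∑ (vectors bools (suc l)) (λ w → ∑ (fillings (map suc ls)) λ F → g (w ∷ F))
    ≡⟨ ∑-product _∷_ bools (vectors bools l) _ ⟩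
  ∑ bools (λ x → ∑ (vectors bools l) λ w →
    ∑ (fillings (map suc ls)) λ F → g ((x ∷ w) ∷ F))
    ≡⟨ ∑-cong bools (λ x → ∑-cong (vectors bools l) λ w →
         ∑-fillings-map-suc ls (g ∘ ((x ∷ w) ∷_))) ⟩
  ∑ bools (λ x → ∑ (vectors bools l) λ w → ∑ (vectors bools (length ls)) λ v →
    ∑ (fillings ls) λ F → g ((x ∷ w) ∷ prepend v F))
    ≡⟨ ∑-cong bools (λ x → ∑-swap (vectors bools l) (vectors bools (length ls))
         λ w v → ∑ (fillings ls) λ F → g ((x ∷ w) ∷ prepend v F)) ⟩
  ∑ bools (λ x → ∑ (vectors bools (length ls)) λ v → ∑ (vectors bools l) λ w →
    ∑ (fillings ls) λ F → g ((x ∷ w) ∷ prepend v F))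
    ≡⟨ ∑-cong bools (λ x → ∑-cong (vectors bools (length ls)) λ v →
         ∑-fillings-∷ l ls (g ∘ prepend (x ∷ v))) ⟨
  ∑ bools (λ x → ∑ (vectors bools (length ls)) λ v →
    ∑ (fillings (l ∷ ls)) λ F → g (prepend (x ∷ v) F))
    ≡⟨ ∑-product _∷_ bools (vectors bools (length ls)) _ ⟨
  ∑ (vectors bools (suc (length ls))) (λ v → ∑ (fillings (l ∷ ls)) λ F → g (prepend v F)) ∎

total : ℕ → ℕ → List ℕ → ℕ
total y c ls = ∑ (fillings ls) λ F → weight y c (length ls) (cell F)

total-south : ∀ y c ls → total y c (ls ++ [ 0 ]) ≡ y * total y c ls
total-south y c ls = begin
  total y c (ls ++ [ 0 ])
    ≡⟨ ∑-fillings-appendEmpty ls _ ⟩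
  ∑ (fillings ls) (λ F → weight y c (length (ls ++ [ 0 ])) (cell (appendEmpty F)))
    ≡⟨ ∑-cong (fillings ls) (λ F → trans
         (cong (λ r → weight y c r (cell (appendEmpty F)))
               (trans (length-++ ls) (+-comm (length ls) 1)))
         (trans (weight-cong (cell-appendEmpty F) y c (suc (length ls)))
                (weight-suc y c (length ls) (cell F) (cell-length F)))) ⟩
  ∑ (fillings ls) (λ F → y * weight y c (length ls) (cell F))
    ≡⟨ ∑-* (fillings ls) y _ ⟩
  y * total y c ls ∎

total-west : ∀ y c ls →
  total y (suc c) (1 ∷ map suc ls) + y * total y c ls ≡ 2 * y * total (suc y) c ls
total-west y c ls = begin
  total y (suc c) (1 ∷ map suc ls) + y * total y c ls
    ≡⟨ cong (_+ y * total y c ls) expand ⟩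
  ∑ (fillings ls) (λ F → ∑ bools λ d → ∑ (vectors bools r) λ v → W d v F) + y * total y c ls
    ≡⟨ cong (∑ (fillings ls) (λ F → ∑ bools λ d → ∑ (vectors bools r) λ v → W d v F) +_)
         (∑-* (fillings ls) y _) ⟨
  ∑ (fillings ls) (λ F → ∑ bools λ d → ∑ (vectors bools r) λ v → W d v F) +
  ∑ (fillings ls) (λ F → y * weight y c r (cell F))
    ≡⟨ ∑-+ (fillings ls) _ _ ⟨
  ∑ (fillings ls) (λ F →
    ∑ bools (λ d → ∑ (vectors bools r) λ v → W d v F) + y * weight y c r (cell F))
    ≡⟨ ∑-cong (fillings ls) (λ F → ∑-weight-extend y c r (cell F)) ⟩
  ∑ (fillings ls) (λ F → 2 * y * weight (suc y) c r (cell F))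
    ≡⟨ ∑-* (fillings ls) (2 * y) _ ⟩
  2 * y * total (suc y) c ls ∎
  where
  r : ℕ
  r = length ls

  W : Bool → Vec Bool r → Filling ls → ℕ
  W d v F = weight y (suc c) (suc r) (extend d v (cell F))

  W⁺ : Bool → Filling (map suc ls) → ℕ
  W⁺ d F = weight y (suc c) (suc (length (map ℕ.suc ls))) (cell {1 ∷ map suc ls} ((d ∷ []) ∷ F))

  W⁺-prepend : ∀ d v F → W⁺ d (prepend v F) ≡ W d v F
  W⁺-prepend d v F = trans
    (cong (λ k → weight y (suc c) (suc k) (cell {1 ∷ map suc ls} ((d ∷ []) ∷ prepend v F)))
          (length-map ℕ.suc ls))
    (weight-cong (cell-prepend d v F) y (suc c) (suc r))

  expand : total y (suc c) (1 ∷ map suc ls) ≡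
           ∑ (fillings ls) λ F → ∑ bools λ d → ∑ (vectors bools r) λ v → W d v F
  expand = begin
    total y (suc c) (1 ∷ map suc ls)
      ≡⟨ ∑-fillings-∷ 1 (map suc ls) _ ⟩
    ∑ bools (λ d → ∑ (fillings (map suc ls)) (W⁺ d))
      ≡⟨ ∑-cong bools (λ d → trans (∑-fillings-map-suc ls (W⁺ d))
           (∑-cong (vectors bools r) λ v → ∑-cong (fillings ls) (W⁺-prepend d v))) ⟩
    ∑ bools (λ d → ∑ (vectors bools r) λ v → ∑ (fillings ls) λ F → W d v F)
      ≡⟨ ∑-cong bools (λ d → ∑-swap (vectors bools r) (fillings ls) (W d)) ⟩
    ∑ bools (λ d → ∑ (fillings ls) λ F → ∑ (vectors bools r) λ v → W d v F)
      ≡⟨ ∑-swap bools (fillings ls) (λ d F → ∑ (vectors bools r) λ v → W d v F) ⟩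
    ∑ (fillings ls) (λ F → ∑ bools λ d → ∑ (vectors bools r) λ v → W d v F) ∎

-- Adding a last step to the boundary

steps : List Step
steps = south ∷ west ∷ []

-- `vectors` branches on the first entry, but the diagram has to grow at the last step of the
-- boundary, where a new empty row or left column appears.
∑-vectors-∷ʳ : ∀ {A : Set} (as : List A) n (f : Vec A (suc n) → ℕ) →
  ∑ (vectors as (suc n)) f ≡ ∑ (vectors as n) λ v → ∑ as λ a → f (v ∷ʳ a)
∑-vectors-∷ʳ as zero f = trans (∑-product _∷_ as [ [] ] f)
  (trans (∑-cong as λ a → +-identityʳ _) (sym (+-identityʳ _)))
∑-vectors-∷ʳ as (suc n) f = begin
  ∑ (vectors as (suc (suc n))) f
    ≡⟨ ∑-product _∷_ as (vectors as (suc n)) f ⟩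
  ∑ as (λ b → ∑ (vectors as (suc n)) λ v → f (b ∷ v))
    ≡⟨ ∑-cong as (λ b → ∑-vectors-∷ʳ as n (f ∘ (b ∷_))) ⟩
  ∑ as (λ b → ∑ (vectors as n) λ v → ∑ as λ a → f (b ∷ (v ∷ʳ a)))
    ≡⟨ ∑-product _∷_ as (vectors as n) _ ⟨
  ∑ (vectors as (suc n)) (λ v → ∑ as λ a → f (v ∷ʳ a)) ∎

columns-south : ∀ {n} (D : Ferrers n) → columns (D ∷ʳ south) ≡ columns D
columns-south []          = refl
columns-south (south ∷ D) = columns-south D
columns-south (west  ∷ D) = cong suc (columns-south D)

columns-west : ∀ {n} (D : Ferrers n) → columns (D ∷ʳ west) ≡ suc (columns D)
columns-west []          = refl
columns-west (south ∷ D) = columns-west D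
columns-west (west  ∷ D) = cong suc (columns-west D)

rowLengths-south : ∀ {n} (D : Ferrers n) → rowLengths (D ∷ʳ south) ≡ rowLengths D ++ [ 0 ]
rowLengths-south []          = refl
rowLengths-south (south ∷ D) = cong₂ _∷_ (columns-south D) (rowLengths-south D)
rowLengths-south (west  ∷ D) = rowLengths-south D

rowLengths-west : ∀ {n} (D : Ferrers n) → rowLengths (D ∷ʳ west) ≡ map suc (rowLengths D)
rowLengths-west []          = refl
rowLengths-west (south ∷ D) = cong₂ _∷_ (columns-west D) (rowLengths-west D)
rowLengths-west (west  ∷ D) = rowLengths-west D

shiftedRowLengths-south : ∀ {n} (D : Ferrers n) →
  shiftedRowLengths (D ∷ʳ south) ≡ shiftedRowLengths D ++ [ 0 ]
shiftedRowLengths-south D = trans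
  (cong₂ (λ c ls → applyUpTo suc c ++ ls) (columns-south D) (rowLengths-south D))
  (sym (++-assoc (applyUpTo suc (columns D)) (rowLengths D) [ 0 ]))

-- Since the inserted rows have lengths 1, ..., c downwards, lengthening each by one and placing a
-- one-cell row on top gives the inserted rows for c + 1 columns.
shiftedRowLengths-west : ∀ {n} (D : Ferrers n) →
  shiftedRowLengths (D ∷ʳ west) ≡ 1 ∷ map suc (shiftedRowLengths D)
shiftedRowLengths-west D = trans
  (cong₂ (λ c ls → applyUpTo suc c ++ ls) (columns-west D) (rowLengths-west D))
  (cong (1 ∷_) (sym (trans (map-++ suc (applyUpTo suc (columns D)) (rowLengths D))
    (cong (_++ map suc (rowLengths D)) (map-applyUpTo suc suc (columns D))))))

diagramTotal : ∀ {n} → ℕ → Ferrers n → ℕ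
diagramTotal y D = total y (columns D) (shiftedRowLengths D)

diagramTotal-south : ∀ {n} y (D : Ferrers n) →
  diagramTotal y (D ∷ʳ south) ≡ y * diagramTotal y D
diagramTotal-south y D = trans
  (cong₂ (total y) (columns-south D) (shiftedRowLengths-south D))
  (total-south y (columns D) (shiftedRowLengths D))

diagramTotal-west : ∀ {n} y (D : Ferrers n) →
  diagramTotal y (D ∷ʳ west) + y * diagramTotal y D ≡ 2 * y * diagramTotal (suc y) D
diagramTotal-west y D = trans
  (cong (_+ y * diagramTotal y D)
    (cong₂ (total y) (columns-west D) (shiftedRowLengths-west D)))
  (total-west y (columns D) (shiftedRowLengths D))

height : ∀ {n} → Ferrers n → ℕ
height D = length (rowLengths D)

height-south : ∀ {n} (D : Ferrers n) → height (D ∷ʳ south) ≡ suc (height D)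
height-south D = trans (cong length (rowLengths-south D))
  (trans (length-++ (rowLengths D)) (+-comm (height D) 1))

height-west : ∀ {n} (D : Ferrers n) → height (D ∷ʳ west) ≡ height D
height-west D = trans (cong length (rowLengths-west D)) (length-map suc (rowLengths D))

-- The polynomials Pₙ and Rₙ and their recurrences

P R : ℕ → ℕ → ℕ
P n y = ∑ (vectors steps n) (diagramTotal y)
R n y = ∑ (vectors steps n) λ D → height D * diagramTotal y D

P-suc : ∀ n y → P (suc n) y ≡ 2 * y * P n (suc y)
P-suc n y = begin
  P (suc n) y
    ≡⟨ ∑-vectors-∷ʳ steps n (diagramTotal y) ⟩
  ∑ (vectors steps n) (λ D → ∑ steps λ s → diagramTotal y (D ∷ʳ s))
    ≡⟨ ∑-cong (vectors steps n) lastStep ⟩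
  ∑ (vectors steps n) (λ D → 2 * y * diagramTotal (suc y) D)
    ≡⟨ ∑-* (vectors steps n) (2 * y) _ ⟩
  2 * y * P n (suc y) ∎
  where
  rearrange : ∀ a b → a + (b + 0) ≡ b + a
  rearrange = solve-∀

  lastStep : ∀ D → ∑ steps (λ s → diagramTotal y (D ∷ʳ s)) ≡ 2 * y * diagramTotal (suc y) D
  lastStep D = trans (rearrange (diagramTotal y (D ∷ʳ south)) _) (trans
    (cong (diagramTotal y (D ∷ʳ west) +_) (diagramTotal-south y D)) (diagramTotal-west y D))

-- Only a south step raises the height, which produces the extra y Pₙ(y); the rest combines as in
-- `P-suc`.
R-suc : ∀ n y → R (suc n) y ≡ y * P n y + 2 * y * R n (suc y)
R-suc n y = begin
  R (suc n) y
    ≡⟨ ∑-vectors-∷ʳ steps n _ ⟩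
  ∑ (vectors steps n) (λ D → ∑ steps λ s → height (D ∷ʳ s) * diagramTotal y (D ∷ʳ s))
    ≡⟨ ∑-cong (vectors steps n) lastStep ⟩
  ∑ (vectors steps n) (λ D → y * diagramTotal y D + 2 * y * (height D * diagramTotal (suc y) D))
    ≡⟨ ∑-+ (vectors steps n) _ _ ⟩
  ∑ (vectors steps n) (λ D → y * diagramTotal y D) +
  ∑ (vectors steps n) (λ D → 2 * y * (height D * diagramTotal (suc y) D))
    ≡⟨ cong₂ _+_ (∑-* (vectors steps n) y _) (∑-* (vectors steps n) (2 * y) _) ⟩
  y * P n y + 2 * y * R n (suc y) ∎
  where
  rearrange : ∀ h s w → suc h * s + (h * w + 0) ≡ s + h * (w + s)
  rearrange = solve-∀

  collect : ∀ y h s t → y * s + h * (2 * y * t) ≡ y * s + 2 * y * (h * t)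
  collect = solve-∀

  lastStep : ∀ D → ∑ steps (λ s → height (D ∷ʳ s) * diagramTotal y (D ∷ʳ s)) ≡
             y * diagramTotal y D + 2 * y * (height D * diagramTotal (suc y) D)
  lastStep D rewrite height-south D | height-west D | diagramTotal-south y D = begin
    suc (height D) * (y * diagramTotal y D) + (height D * diagramTotal y (D ∷ʳ west) + 0)
      ≡⟨ rearrange (height D) (y * diagramTotal y D) _ ⟩
    y * diagramTotal y D + height D * (diagramTotal y (D ∷ʳ west) + y * diagramTotal y D)
      ≡⟨ cong (λ t → y * diagramTotal y D + height D * t) (diagramTotal-west y D) ⟩
    y * diagramTotal y D + height D * (2 * y * diagramTotal (suc y) D)
      ≡⟨ collect y (height D) (diagramTotal y D) (diagramTotal (suc y) D) ⟩
    y * diagramTotal y D + 2 * y * (height D * diagramTotal (suc y) D) ∎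

-- Unrolling `P-suc` gives the rising factorial Pₙ(y) = 2ⁿ y(y+1)⋯(y+n-1), so both sides are 2ⁿ
-- y(y+1)⋯(y+n).
P-shift : ∀ n y → (y + n) * P n y ≡ y * P n (suc y)
P-shift zero    y = cong (_* P 0 y) (+-identityʳ y)
P-shift (suc n) y = begin
  (y + suc n) * P (suc n) y
    ≡⟨ cong₂ _*_ (+-suc y n) (P-suc n y) ⟩
  (suc y + n) * (2 * y * P n (suc y))
    ≡⟨ rearrange (suc y + n) (2 * y) (P n (suc y)) ⟩
  2 * y * ((suc y + n) * P n (suc y))
    ≡⟨ cong (2 * y *_) (P-shift n (suc y)) ⟩
  2 * y * (suc y * P n (suc (suc y)))
    ≡⟨ collect y (P n (suc (suc y))) ⟩
  y * (2 * suc y * P n (suc (suc y)))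
    ≡⟨ cong (y *_) (P-suc n (suc y)) ⟨
  y * P (suc n) (suc y) ∎
  where
  rearrange : ∀ a b c → a * (b * c) ≡ b * (a * c)
  rearrange = solve-∀
  collect : ∀ y p → 2 * y * ((1 + y) * p) ≡ y * (2 * (1 + y) * p)
  collect = solve-∀

-- The weighted mean height (n+1)(2y+n) / (4(y+n)) in cross-multiplied form. The induction needs
-- every `y`, because the recurrences pass from `y` to `suc y`.
R-P : ∀ n y → 4 * (y + n) * R (suc n) y ≡ suc n * (2 * y + n) * P (suc n) y
R-P zero    y = begin
  4 * (y + 0) * R 1 y              ≡⟨ cong (4 * (y + 0) *_) (R-suc 0 y) ⟩
  4 * (y + 0) * (y * 1 + 2 * y * 0) ≡⟨ rearrange y ⟩
  1 * (2 * y + 0) * (2 * y * 1)    ≡⟨ cong (1 * (2 * y + 0) *_) (P-suc 0 y) ⟨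
  1 * (2 * y + 0) * P 1 y          ∎
  where
  rearrange : ∀ y → 4 * (y + 0) * (y * 1 + 2 * y * 0) ≡ 1 * (2 * y + 0) * (2 * y * 1)
  rearrange = solve-∀
R-P (suc n) y = begin
  4 * (y + suc n) * R (2 + n) y
    ≡⟨ cong (4 * (y + suc n) *_) (R-suc (suc n) y) ⟩
  4 * (y + suc n) * (y * p + 2 * y * r)
    -- As y + (n+1) = (y+1) + n, one factor serves both `P-shift` for `p` and the induction
    -- hypothesis at `suc y` for `r`; both terms become multiples of `q`.
    ≡⟨ rearrange y n p r ⟩
  4 * y * ((y + suc n) * p) + 2 * y * (4 * (suc y + n) * r)
    ≡⟨ cong₂ (λ s t → 4 * y * s + 2 * y * t) (P-shift (suc n) y) (R-P n (suc y)) ⟩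
  4 * y * (y * q) + 2 * y * (suc n * (2 * suc y + n) * q)
    ≡⟨ collect y n q ⟩
  (2 + n) * (2 * y + suc n) * (2 * y * q)
    ≡⟨ cong ((2 + n) * (2 * y + suc n) *_) (P-suc (suc n) y) ⟨
  (2 + n) * (2 * y + suc n) * P (2 + n) y ∎
  where
  p q r : ℕ
  p = P (suc n) y
  q = P (suc n) (suc y)
  r = R (suc n) (suc y)
  rearrange : ∀ y n p r → 4 * (y + (1 + n)) * (y * p + 2 * y * r) ≡
    4 * y * ((y + (1 + n)) * p) + 2 * y * (4 * ((1 + y) + n) * r)
  rearrange = solve-∀
  collect : ∀ y n q → 4 * y * (y * q) + 2 * y * ((1 + n) * (2 * (1 + y) + n) * q) ≡
    (2 + n) * (2 * y + (1 + n)) * (2 * y * q)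
  collect = solve-∀

-- Correctness of the Boolean test

T-allBelow : ∀ n {p} → T (allBelow n p) ⇔ (∀ a → a < n → T (p a))
T-allBelow n = mk⇔ (⇒′ n) (⇐′ n)
  where
  ⇒′ : ∀ n {p} → T (allBelow n p) → ∀ a → a < n → T (p a)
  ⇒′ (suc n) t zero    _   = proj₁ (to T-∧ t)
  ⇒′ (suc n) t (suc a) a<n = ⇒′ n (proj₂ (to T-∧ t)) a (s≤s⁻¹ a<n)

  ⇐′ : ∀ n {p} → (∀ a → a < n → T (p a)) → T (allBelow n p)
  ⇐′ zero    h = _
  ⇐′ (suc n) h = from T-∧ (h 0 (s≤s z≤n) , ⇐′ n λ a a<n → h (suc a) (s≤s a<n))

T-anyBelow : ∀ n {p} → T (anyBelow n p) ⇔ ∃ λ a → a < n × T (p a)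
T-anyBelow n = mk⇔ (⇒′ n) (λ (a , a<n , t) → ⇐′ n a a<n t)
  where
  ⇒′ : ∀ n {p} → T (anyBelow n p) → ∃ λ a → a < n × T (p a)
  ⇒′ (suc n) t with to T-∨ t
  ... | inj₁ t₀ = 0 , s≤s z≤n , t₀
  ... | inj₂ t₁ with a , a<n , t₂ ← ⇒′ n t₁ = suc a , s≤s a<n , t₂

  ⇐′ : ∀ n {p} a → a < n → T (p a) → T (anyBelow n p)
  ⇐′ (suc n) zero    _   t = from T-∨ (inj₁ t)
  ⇐′ (suc n) {p} (suc a) a<n t = from (T-∨ {p 0}) (inj₂ (⇐′ n a (s≤s⁻¹ a<n) t))

T-not : ∀ {x} → T (not x) ⇔ (¬ T x)
T-not {false} = mk⇔ (λ _ ()) _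
T-not {true}  = mk⇔ (λ ()) (λ h → h _)

T-⇒ : ∀ {x y} → T (x ⇒ y) ⇔ (T x → T y)
T-⇒ {false} = mk⇔ (λ _ ()) _
T-⇒ {true}  = mk⇔ (λ t _ → t) (λ h → h _)

T-noneAfter : ∀ c {p q} → T (noneAfter c p q) ⇔
  (∀ b b′ → b < b′ → b′ < c → T (p b) → ¬ T (q b′))
T-noneAfter c = mk⇔ (⇒′ c) (⇐′ c)
  where
  ⇒′ : ∀ c {p q} → T (noneAfter c p q) →
       ∀ b b′ → b < b′ → b′ < c → T (p b) → ¬ T (q b′)
  ⇒′ (suc c) {p} t zero (suc b′) _ b′<c tp =
    to T-not (to (T-allBelow c) (to (T-⇒ {p 0}) (proj₁ (to T-∧ t)) tp) b′ (s≤s⁻¹ b′<c))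
  ⇒′ (suc c) {p} {q} t (suc b) (suc b′) b<b′ b′<c tp =
    ⇒′ c (proj₂ (to (T-∧ {p 0 ⇒ allBelow c (not ∘ q ∘ suc)}) t)) b b′
      (s≤s⁻¹ b<b′) (s≤s⁻¹ b′<c) tp

  ⇐′ : ∀ c {p q} → (∀ b b′ → b < b′ → b′ < c → T (p b) → ¬ T (q b′)) →
       T (noneAfter c p q)
  ⇐′ zero    h = _
  ⇐′ (suc c) {p} h = from T-∧
    ( from (T-⇒ {p 0}) (λ tp → from (T-allBelow c) λ b b<c →
        from T-not (h 0 (suc b) (s≤s z≤n) (s≤s b<c) tp))
    , ⇐′ c (λ b b′ b<b′ b′<c → h (suc b) (suc b′) (s≤s b<b′) (s≤s b′<c)))

T-isOne : ∀ {m} → T (isOne m) ⇔ m ≡ just true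
T-isOne {nothing}    = mk⇔ (λ ()) (λ ())
T-isOne {just false} = mk⇔ (λ ()) (λ ())
T-isOne {just true}  = mk⇔ (λ _ → refl) _

T-isZero : ∀ {m} → T (isZero m) ⇔ m ≡ just false
T-isZero {nothing}    = mk⇔ (λ ()) (λ ())
T-isZero {just false} = mk⇔ (λ _ → refl) _
T-isZero {just true}  = mk⇔ (λ ()) (λ ())

T-blocking : ∀ M a b → T (blocking M a b) ⇔
  (M a b ≡ just false × (a ≡ b ⊎ ∃ λ a′ → a′ < a × M a′ b ≡ just true))
T-blocking M a b = mk⇔ ⇒′ ⇐′
  where
  ⇒′ : T (blocking M a b) → _
  ⇒′ t with t₀ , t₁ ← to T-∧ t with to T-∨ t₁
  ... | inj₁ a≡b = to T-isZero t₀ , inj₁ (≡ᵇ⇒≡ a b a≡b)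
  ... | inj₂ t₂ with a′ , a′<a , t₃ ← to (T-anyBelow a) t₂ =
    to T-isZero t₀ , inj₂ (a′ , a′<a , to T-isOne t₃)

  ⇐′ : _ → T (blocking M a b)
  ⇐′ (e , inj₁ a≡b) = from T-∧ (from T-isZero e , from T-∨ (inj₁ (≡⇒≡ᵇ a b a≡b)))
  ⇐′ (e , inj₂ (a′ , a′<a , e′)) = from T-∧ (from T-isZero e ,
    from (T-∨ {a ≡ᵇ b}) (inj₂ (from (T-anyBelow a) (a′ , a′<a , from T-isOne e′))))

-- The intermediate form, with natural numbers as positions, that is matched below with the
-- `Fin`-indexed conditions of `IsTypeB`.
T-valid : ∀ c r M → T (valid c r M) ⇔
  ( (∀ b → b < c → ∃ λ a → a < r × M a b ≡ just true)
  × (∀ a → a < r → ∀ b b′ → b < b′ → b′ < c →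
     M a b ≡ just true → M a b′ ≡ just false →
     ¬ (a ≡ b′ ⊎ ∃ λ a′ → a′ < a × M a′ b′ ≡ just true)))
T-valid c r M = mk⇔
  (λ t → let t₁ , t₂ = to T-∧ t in
    (λ b b<c → let a , a<r , t₃ = to (T-anyBelow r) (to (T-allBelow c) t₁ b b<c)
               in a , a<r , to T-isOne t₃) ,
    λ a a<r b b′ b<b′ b′<c e e′ z →
      to (T-noneAfter c) (to (T-allBelow r) t₂ a a<r) b b′ b<b′ b′<c
        (from T-isOne e) (from (T-blocking M a b′) (e′ , z)))
  (λ (h₁ , h₂) → from T-∧
    ( from (T-allBelow c) (λ b b<c → let a , a<r , e = h₁ b b<c in
        from (T-anyBelow r) (a , a<r , from T-isOne e))
    , from (T-allBelow r) λ a a<r → from (T-noneAfter c) λ b b′ b<b′ b′<c t t′ →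
        let e′ , z = to (T-blocking M a b′) t′ in
        h₂ a a<r b b′ b<b′ b′<c (to T-isOne t) e′ z))

look-lookup : ∀ {n} (v : Vec Bool n) j → look v (toℕ j) ≡ just (Vec.lookup v j)
look-lookup (x ∷ v) zero    = refl
look-lookup (x ∷ v) (suc j) = look-lookup v j

look-just : ∀ {n} (v : Vec Bool n) {b x} → look v b ≡ just x →
            ∃ λ j → toℕ j ≡ b × Vec.lookup v j ≡ x
look-just (x ∷ v) {zero}  e = zero , refl , just-injective e
look-just (x ∷ v) {suc b} e with j , refl , e′ ← look-just v e = suc j , refl , e′

cell-row : ∀ {ls} (F : Filling ls) i b → cell F (toℕ i) b ≡ look (row F i) b
cell-row (w ∷ F) zero    b = refl
cell-row (w ∷ F) (suc i) b = cell-row F i b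

cell-entry : ∀ {ls} (F : Filling ls) i j → cell F (toℕ i) (toℕ j) ≡ just (entry F i j)
cell-entry F i j = trans (cell-row F i (toℕ j)) (look-lookup (row F i) j)

cell-just : ∀ {ls} (F : Filling ls) i {b x} → cell F (toℕ i) b ≡ just x →
            ∃ λ j → toℕ j ≡ b × entry F i j ≡ x
cell-just F i {b} e = look-just (row F i) (trans (sym (cell-row F i b)) e)

lookup-inserted : ∀ (f : ℕ → ℕ) c ms i → toℕ i < c →
                  lookup (applyUpTo f c ++ ms) i ≡ f (toℕ i)
lookup-inserted f (suc c) ms zero    _   = refl
lookup-inserted f (suc c) ms (suc i) i<c = lookup-inserted (f ∘ suc) c ms i (s≤s⁻¹ i<c)

rowLengths≤columns : ∀ {n} (D : Ferrers n) → All (_≤ columns D) (rowLengths D)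
rowLengths≤columns []          = []
rowLengths≤columns (south ∷ D) = ≤-refl ∷ rowLengths≤columns D
rowLengths≤columns (west  ∷ D) = All.map m≤n⇒m≤1+n (rowLengths≤columns D)

module _ {n} (D : Ferrers n) (F : Filling (shiftedRowLengths D)) where
  private
    ls : List ℕ
    ls = shiftedRowLengths D

    c r : ℕ
    c = columns D
    r = length ls

  lookup≤columns : ∀ i → lookup ls i ≤ c
  lookup≤columns i = All.lookup
    (++⁺ (applyUpTo⁺₁ suc c id) (rowLengths≤columns D)) (∈-lookup i)

  -- The last cell of inserted row i is thus in column i, counted from 0, which justifies the test
  -- `a ≡ᵇ b` in `blocking`.
  lookup-diagonal : ∀ i → toℕ i < c → lookup ls i ≡ suc (toℕ i)
  lookup-diagonal = lookup-inserted suc c (rowLengths D)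

  ∀row : (Q : ℕ → Set) → (∀ (i : Fin r) → Q (toℕ i)) → ∀ a → a < r → Q a
  ∀row Q h a a<r = subst Q (toℕ-fromℕ< a<r) (h (fromℕ< a<r))

  IsTypeB⇒valid : IsTypeB (D , F) → T (valid c r (cell F))
  IsTypeB⇒valid t = from (T-valid c r (cell F)) (column , ∀row _ rows)
    where
    open IsTypeB t
    column : ∀ b → b < c → ∃ λ a → a < r × cell F a b ≡ just true
    column b b<c with i , j , j≡k , e ← column-has-one (fromℕ< b<c)
      with refl ← trans j≡k (toℕ-fromℕ< b<c) =
      toℕ i , toℕ<n i , trans (cell-entry F i j) (cong just e)

    rows : ∀ i b b′ → b < b′ → b′ < c →
           cell F (toℕ i) b ≡ just true → cell F (toℕ i) b′ ≡ just false →
           ¬ (toℕ i ≡ b′ ⊎ ∃ λ a′ → a′ < toℕ i × cell F a′ b′ ≡ just true)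
    rows i b b′ b<b′ b′<c p q z
      with j , refl , e ← cell-just F i p | j′ , refl , e′ ← cell-just F i q with z
    -- Equal coordinates mean a diagonal cell only in an inserted row. Here the row index equals the
    -- column `b′`, which is below `c`, so the row is inserted and `diagonal-zero` contradicts the 1
    -- at `j`.
    ... | inj₁ i≡j′ = contradiction (trans (sym e) (diagonal-zero i i<c j′
            (trans (cong suc (sym i≡j′)) (sym (lookup-diagonal i i<c))) e′ j)) λ ()
      where
      i<c : toℕ i < c
      i<c = subst (_< c) (sym i≡j′) b′<c
    ... | inj₂ (a′ , a′<i , s) = ∀row
      (λ a → a < toℕ i → ¬ (cell F a (toℕ j′) ≡ just true))
      (λ i′ i′<i s → let j″ , j″≡j′ , e″ = cell-just F i′ s in
        no-bad-zero i j′ e′ ((i′ , j″ , i′<i , j″≡j′ , e″) , j , b<b′ , e))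
      a′ (<-trans a′<i (toℕ<n i)) a′<i s

  valid⇒IsTypeB : T (valid c r (cell F)) → IsTypeB (D , F)
  valid⇒IsTypeB t with column , rows ← to (T-valid c r (cell F)) t = record
    { column-has-one = λ k → let a , a<r , e = column (toℕ k) (toℕ<n k) in
        ∀row (λ a → cell F a (toℕ k) ≡ just true → OneInColumn F (toℕ k))
          (λ i e → i , cell-just F i e) a a<r e
    ; no-bad-zero = λ i j e ((i′ , j′ , i′<i , j′≡j , e′) , j″ , j″<j , e″) →
        rows (toℕ i) (toℕ<n i) (toℕ j″) (toℕ j) j″<j (<-≤-trans (toℕ<n j) (lookup≤columns i))
          (trans (cell-entry F i j″) (cong just e″))
          (trans (cell-entry F i j) (cong just e))
          (inj₂ (toℕ i′ , i′<i , subst (λ b → cell F (toℕ i′) b ≡ just true) j′≡j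
            (trans (cell-entry F i′ j′) (cong just e′))))
    ; diagonal-zero = λ i i<c j sj≡l e j′ → diagonal i i<c j sj≡l e j′ _ refl
    }
    where
    diagonal : ∀ i → toℕ i < c → ∀ j → suc (toℕ j) ≡ lookup ls i → entry F i j ≡ false →
               ∀ j′ x → entry F i j′ ≡ x → x ≡ false
    diagonal i i<c j sj≡l e j′ false e′ = refl
    -- A 1 in the row of a diagonal zero lies strictly left of it, since the diagonal cell is the
    -- last one and the two entries differ; `rows` excludes this.
    diagonal i i<c j sj≡l e j′ true  e′ =
      ⊥-elim (rows (toℕ i) (toℕ<n i) (toℕ j′) (toℕ j) j′<j (<-≤-trans (toℕ<n j) (lookup≤columns i))
        (trans (cell-entry F i j′) (cong just e′))
        (trans (cell-entry F i j) (cong just e))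
        (inj₁ (suc-injective (trans (sym (lookup-diagonal i i<c)) (sym sj≡l)))))
      where
      j′≢j : ¬ (toℕ j′ ≡ toℕ j)
      j′≢j j′≡j with refl ← toℕ-injective j′≡j with () ← trans (sym e) e′

      j′<j : toℕ j′ < toℕ j
      j′<j = ≤∧≢⇒< (s≤s⁻¹ (subst (toℕ j′ <_) (sym sj≡l) (toℕ<n j′))) j′≢j

  does-isTypeB? : does (isTypeB? (D , F)) ≡ valid c r (cell F)
  does-isTypeB? = does-⇔ (mk⇔ IsTypeB⇒valid valid⇒IsTypeB) (isTypeB? (D , F)) (T? _)

-- From sums over tableaux to the expectation

∑-filter : ∀ {A : Set} {Q : A → Set} (Q? : Decidable Q) (xs : List A) f →
           ∑ (filter Q? xs) f ≡ ∑ xs λ x → f x * 𝟙 (does (Q? x))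
∑-filter Q? []       f = refl
∑-filter Q? (x ∷ xs) f with does (Q? x)
... | false = cong₂ _+_ (sym (*-zeroʳ (f x))) (∑-filter Q? xs f)
... | true  = cong₂ _+_ (sym (*-identityʳ (f x))) (∑-filter Q? xs f)

-- At y = 1 the power in `weight` is 1, so `weight` becomes the indicator of `valid`, which by
-- `does-isTypeB?` is the indicator of the tableaux.
∑-tableaux : ∀ n (g : Ferrers n → ℕ) →
  ∑ (tableaux n) (g ∘ proj₁) ≡ ∑ (vectors steps n) λ D → g D * diagramTotal 1 D
∑-tableaux n g = begin
  ∑ (tableaux n) (g ∘ proj₁)
    ≡⟨ ∑-filter isTypeB? (allFilled n) (g ∘ proj₁) ⟩
  ∑ (allFilled n) term
    ≡⟨ ∑-concatMap (λ D → map (D ,_) (fillings (shiftedRowLengths D))) (vectors steps n) term ⟩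
  ∑ (vectors steps n) (λ D → ∑ (map (D ,_) (fillings (shiftedRowLengths D))) term)
    ≡⟨ ∑-cong (vectors steps n) (λ D → trans
         (∑-map (D ,_) (fillings (shiftedRowLengths D)) term)
         (trans (∑-cong (fillings (shiftedRowLengths D)) λ F → cong (g D *_) (indicator D F))
                (∑-* (fillings (shiftedRowLengths D)) (g D) _))) ⟩
  ∑ (vectors steps n) (λ D → g D * diagramTotal 1 D) ∎
  where
  term : Filled n → ℕ
  term T = g (proj₁ T) * 𝟙 (does (isTypeB? T))

  indicator : ∀ D F → 𝟙 (does (isTypeB? (D , F))) ≡
    weight 1 (columns D) (length (shiftedRowLengths D)) (cell F)
  indicator D F rewrite does-isTypeB? D F
    | ^-zeroˡ (countBelow (length (shiftedRowLengths D)) (free (columns D) (cell F))) =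
    sym (*-identityʳ _)

length≡∑ : ∀ {A : Set} (xs : List A) → length xs ≡ ∑ xs λ _ → 1
length≡∑ []       = refl
length≡∑ (x ∷ xs) = cong suc (length≡∑ xs)

length-tableaux : ∀ n → length (tableaux n) ≡ P n 1
length-tableaux n = trans (length≡∑ (tableaux n)) (trans (∑-tableaux n λ _ → 1)
  (∑-cong (vectors steps n) λ D → *-identityˡ _))

4*rows≡ : ∀ n → R (suc n) 1 * 4 ≡ (suc n + 1) * P (suc n) 1
-- At y = 1 the factors 4(y+n) and 2y+n in `R-P` become 4(n+1) and n+2, so n+1 cancels.
4*rows≡ n = *-cancelˡ-≡ _ _ (suc n) (begin
  suc n * (R (suc n) 1 * 4)     ≡⟨ rearrange n (R (suc n) 1) ⟩
  4 * (1 + n) * R (suc n) 1     ≡⟨ R-P n 1 ⟩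
  suc n * (2 * 1 + n) * P (suc n) 1 ≡⟨ collect n (P (suc n) 1) ⟩
  suc n * ((suc n + 1) * P (suc n) 1) ∎)
  where
  rearrange : ∀ n r → (1 + n) * (r * 4) ≡ 4 * (1 + n) * r
  rearrange = solve-∀
  collect : ∀ n p → (1 + n) * (2 * 1 + n) * p ≡ (1 + n) * (((1 + n) + 1) * p)
  collect = solve-∀

-- Opened only here: in the sections (x +_) above, +_ would be ambiguous.
open import Data.Integer using (+_)

-- `fromℚᵘ` sends an unnormalised fraction to the quotient `_/_`, so cross-multiplied equality of
-- integers is enough.
/-cross : ∀ a b k d .{{_ : NonZero b}} .{{_ : NonZero d}} → a * d ≡ k * b → + a / b ≡ + k / d
/-cross a (suc b) k (suc d) e = fromℚᵘ-cong {mkℚᵘ (+ a) b} {mkℚᵘ (+ k) d} (*≡* (begin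
  + a ℤ.* + suc d ≡⟨ ℤ.pos-* a (suc d) ⟨
  + (a * suc d)   ≡⟨ cong +_ e ⟩
  + (k * suc b)   ≡⟨ ℤ.pos-* k (suc b) ⟩
  + k ℤ.* + suc b ∎))

mainTheorem4 : (n : ℕ) → 1 ≤ n → 𝔼 n numRows ≡ + (n + 1) / 4
mainTheorem4 (suc n) _ =
  /-cross (∑ (tableaux (suc n)) numRows) (length (tableaux (suc n))) (suc n + 1) 4
    {{tableaux-nonEmpty (suc n)}} (begin
      ∑ (tableaux (suc n)) numRows * 4      ≡⟨ cong (_* 4) (∑-tableaux (suc n) height) ⟩
      R (suc n) 1 * 4                       ≡⟨ 4*rows≡ n ⟩
      (suc n + 1) * P (suc n) 1             ≡⟨ cong ((suc n + 1) *_) (length-tableaux (suc n)) ⟨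
      (suc n + 1) * length (tableaux (suc n)) ∎)
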